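{- Let $D \subseteq {}^3({}^\omega 2)$ be defined by $$D = \{(x,y,z) \in {}^3({}^\omega 2) : (\exists n)(x(n) \neq y(n) \wedge x(n) \neq z(n) \wedge y(n+1) \neq z(n+1))\}.$$ Then $D$ is dense open in ${}^3({}^\omega 2)$. Moreover, if $p$ is an $E_0$-tree with witnessing strings $s, v_n^i$ ($n\in\omega$, $i\in 2$) and $\Phi:{}^\omega 2\to[p]$ is its canonical map, then $$(\Phi(\widetilde{010}), \Phi(\widetilde{110}), \Phi(\tilde 1)) \notin D.$$ Consequently $E_0$ does not have the $3$-Mycielski property.
   Context: For $\sigma\in{}^{<\omega}2$ of length $k>0$, $\tilde\sigma\in{}^\omega 2$ is defined by $\tilde\sigma(n)=\sigma(j)$ where $0\le j<k$ and $j\equiv n \pmod k$ (so $\tilde 1$ is the constant $1$ sequence, $\widetilde{010}$ is $010010010\dots$). $E_0$ is the equivalence relation on ${}^\omega 2$ given by $x\,E_0\,y$ iff $(\exists n)(\forall k>n)(x(k)=y(k))$. An $E_0$-tree is a tree $p\subseteq{}^{<\omega}2$ for which there are strings $s, v_n^i\in{}^{<\omega}2$ ($n\in\omega$, $i\in 2$) with $\langle i\rangle\subseteq v_n^i$ (i.e. $v_n^i$ begins with $i$) and $|v_n^0|=|v_n^1|$, such that, setting $\varphi(\emptyset)=s$ and $\varphi(\sigma)=s^\frown v_0^{\sigma(0)}{}^\frown\cdots{}^\frown v_{|\sigma|-1}^{\sigma(|\sigma|-1)}$ for nonempty $\sigma\in{}^{<\omega}2$, $p$ is the $\subseteq$-downward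 closure of $\{\varphi(\sigma):\sigma\in{}^{<\omega}2\}$. Its canonical map is $\Phi(x)=\bigcup_{n}\varphi(x\upharpoonright n)$. For an equivalence relation $E$ on a set $X$ and $n\in\omega$, $[X]^n_E=\{(x_0,\dots,x_{n-1})\in{}^nX : (\forall i\neq j)\,\neg(x_i\,E\,x_j)\}$. For equivalence relations $E,F$ on Polish spaces $X,Y$, $E\le_{\Delta^1_1}F$ means there is a $\Delta^1_1$ (Borel) function $\Phi:X\to Y$ with $a\,E\,b\iff\Phi(a)\,F\,\Phi(b)$; $E\equiv_{\Delta^1_1}F$ means both directions hold. An equivalence relation $E$ on a Polish space $X$ has the $n$-Mycielski property iff for every comeager $C\subseteq{}^nX$ there is a $\Delta^1_1$ set $A\subseteq X$ with $E\equiv_{\Delta^1_1}E\upharpoonright A$ and $[A]^n_E\subseteq C$. -}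

module Defs where

open import Data.Bool using (Bool; true; false)
open import Data.Nat using (ℕ; zero; suc; _<_; NonZero)
open import Data.Nat.DivMod using (_mod_)
open import Data.List using (List; []; _∷_; _++_; length; lookup)
open import Data.Product using (Σ; ∃; ∃-syntax; _×_; _,_; proj₁)
open import Relation.Binary.PropositionalEquality using (_≡_; _≢_)
open import Relation.Nullary using (¬_)
open import Function.Bundles using (_⇔_)

Cantor : Set
Cantor = ℕ → Bool

restrict : Cantor → ℕ → List Bool
restrict x zero    = []
restrict x (suc n) = x 0 ∷ restrict (λ k → x (suc k)) n

_≺_ : List Bool → Cantor → Set
σ ≺ x = restrict x (length σ) ≡ σ

tilde : (σ : List Bool) → .{{NonZero (length σ)}} → Cantor
tilde σ n = lookup σ (n mod length σ)

E0 : Cantor → Cantor → Set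
E0 x y = ∃[ n ] (∀ k → n < k → x k ≡ y k)

Cantor³ : Set
Cantor³ = Cantor × Cantor × Cantor

Basic³ : Set
Basic³ = List Bool × List Bool × List Bool

_∈B_ : Cantor³ → Basic³ → Set
(x , y , z) ∈B (σ , τ , ρ) = σ ≺ x × τ ≺ y × ρ ≺ z

IsOpen³ : (Cantor³ → Set) → Set
IsOpen³ U = ∀ t → U t → ∃[ b ] (t ∈B b × (∀ t′ → t′ ∈B b → U t′))

IsDense³ : (Cantor³ → Set) → Set
IsDense³ U = ∀ (b : Basic³) → ∃[ t ] (t ∈B b × U t)

IsDenseOpen³ : (Cantor³ → Set) → Set
IsDenseOpen³ U = IsOpen³ U × IsDense³ U

IsComeager³ : (Cantor³ → Set) → Set₁
IsComeager³ C =
  Σ (ℕ → Cantor³ → Set) λ U →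
    (∀ k → IsDenseOpen³ (U k)) × (∀ t → (∀ k → U k t) → C t)

D : Cantor³ → Set
D (x , y , z) = ∃[ n ] (x n ≢ y n × x n ≢ z n × y (suc n) ≢ z (suc n))

record E0Tree : Set where
  field
    s      : List Bool
    v      : ℕ → Bool → List Bool
    v-head : ∀ n i → ∃[ w ] (v n i ≡ i ∷ w)
    v-len  : ∀ n → length (v n false) ≡ length (v n true)

  φ-from : ℕ → List Bool → List Bool
  φ-from k []      = []
  φ-from k (b ∷ σ) = v k b ++ φ-from (suc k) σ

  φ : List Bool → List Bool
  φ σ = s ++ φ-from 0 σ

-- Φ is the canonical map of p : Φ(x) = ⋃ₙ φ(x ↾ n)
-- (i.e. every φ(x ↾ n) is an initial segment of Φ(x); since the
-- lengths of φ(x ↾ n) are unbounded this determines Φ uniquely)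
IsCanonicalMap : E0Tree → (Cantor → Cantor) → Set
IsCanonicalMap p Φ = ∀ x n → E0Tree.φ p (restrict x n) ≺ Φ x

data BorelCode : Set where
  basic : List Bool → BorelCode
  compl : BorelCode → BorelCode
  union : (ℕ → BorelCode) → BorelCode

⟦_⟧ : BorelCode → Cantor → Set
⟦ basic σ ⟧ x = σ ≺ x
⟦ compl c ⟧ x = ¬ ⟦ c ⟧ x
⟦ union f ⟧ x = ∃[ n ] ⟦ f n ⟧ x

IsBorelSet : (Cantor → Set) → Set
IsBorelSet A = ∃[ c ] (∀ x → A x ⇔ ⟦ c ⟧ x)

IsBorelFun : (Cantor → Cantor) → Set
IsBorelFun f = ∀ σ → IsBorelSet (λ x → σ ≺ f x)

IsBorelFunOn : (A : Cantor → Set) → (Σ Cantor A → Cantor) → Set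
IsBorelFunOn A g =
  ∀ σ → ∃[ c ] (∀ (a : Σ Cantor A) → (σ ≺ g a) ⇔ ⟦ c ⟧ (proj₁ a))

E0≤E0↾ : (Cantor → Set) → Set
E0≤E0↾ A =
  Σ (Cantor → Σ Cantor A) λ f →
    IsBorelFun (λ x → proj₁ (f x)) ×
    (∀ a b → E0 a b ⇔ E0 (proj₁ (f a)) (proj₁ (f b)))

E0↾≤E0 : (Cantor → Set) → Set
E0↾≤E0 A =
  Σ (Σ Cantor A → Cantor) λ g →
    IsBorelFunOn A g ×
    (∀ a b → E0 (proj₁ a) (proj₁ b) ⇔ E0 (g a) (g b))

Pairwise⊆ : (Cantor → Set) → (Cantor³ → Set) → Set
Pairwise⊆ A C =
  ∀ x y z → A x → A y → A z →
    ¬ E0 x y → ¬ E0 x z → ¬ E0 y z → C (x , y , z)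

E0-3-Mycielski : Set₁
E0-3-Mycielski =
  ∀ (C : Cantor³ → Set) → IsComeager³ C →
    Σ (Cantor → Set) λ A →
      IsBorelSet A × E0≤E0↾ A × E0↾≤E0 A × Pairwise⊆ A C

{-# OPTIONS --safe #-}
module Submission where

-- Suppose f reduces E0 to its restriction to a set all of whose pairwise inequivalent
-- triples lie in D. Fix a base point x and change it alternately in two ways, at finitely
-- many places each time. After each change the images of the current points a, c agree
-- with f x beyond some k; the next change is made so far out that, by continuity of f at
-- the current point, the image is unchanged up to k. Hence in the limit the places where
-- f a differs from f x and those where f c differs from f x are finite blocks separated by
-- gaps, which is incompatible with (f a , f x , f c) ∈ D.
--
-- Constructively, continuity is obtained from a case distinction on WLPO, which is allowed
-- since the goal is ⊥. If WLPO fails then f is continuous along all sequences, because a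
-- discontinuity would decide WLPO, and x = 0^ω will do. If WLPO holds then the forcing
-- relation for Borel codes is decidable, and x is a point generic for the codes of f.

open import Defs
open import Data.Bool using (Bool; true; false; not)
import Data.Bool.Properties as Bool
open import Data.Bool.Properties using (not-¬; ¬-not)
open import Data.Empty using (⊥; ⊥-elim)
open import Data.List using (List; []; _∷_; _∷ʳ_; _++_; length; drop; replicate)
open import Data.List.Properties using (length-++; ++-assoc; ∷-injectiveˡ; ∷-injectiveʳ; ≡-dec)
open import Data.List.Relation.Binary.Prefix.Heterogeneous using (Prefix; []; _∷_; _++ᵖ_)
import Data.List.Relation.Binary.Prefix.Heterogeneous.Properties as Prefix
open import Data.Nat
open import Data.Nat.Induction using (<-rec)
open import Data.Nat.Properties
open import Data.Product using (∃-syntax; _×_; _,_; proj₁; proj₂; map₂)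
open import Data.Sum using (_⊎_; inj₁; inj₂)
open import Data.Unit using (⊤; tt)
open import Function using (_∘_; case_of_)
open import Function.Bundles using (module Equivalence)
open import Relation.Binary.PropositionalEquality
open import Relation.Nullary
open import Relation.Nullary.Decidable using (dec-true; decidable-stable)

-- Strings, prefixes and overwriting initial segments

infix 4 _≐_ _⊑_

_≐_ : Cantor → Cantor → Set
x ≐ y = ∀ j → x j ≡ y j

_⊑_ : List Bool → List Bool → Set
_⊑_ = Prefix _≡_

⊑-trans : ∀ {p q r} → p ⊑ q → q ⊑ r → p ⊑ r
⊑-trans = Prefix.trans trans

⊑-refl : ∀ {p} → p ⊑ p
⊑-refl {[]}    = []
⊑-refl {_ ∷ _} = refl ∷ ⊑-refl

_⊑?_ : ∀ p q → Dec (p ⊑ q)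
_⊑?_ = Prefix.prefix? Bool._≟_

⊑⇒++ : ∀ {p q} → p ⊑ q → ∃[ w ] (q ≡ p ++ w)
⊑⇒++ {q = q} []  = q , refl
⊑⇒++ (refl ∷ p⊑q) = map₂ (cong (_ ∷_)) (⊑⇒++ p⊑q)

length-restrict : ∀ x n → length (restrict x n) ≡ n
length-restrict x zero    = refl
length-restrict x (suc n) = cong suc (length-restrict (x ∘ suc) n)

restrict-cong : ∀ {x y} n → (∀ j → j < n → x j ≡ y j) → restrict x n ≡ restrict y n
restrict-cong zero    x≐y = refl
restrict-cong (suc n) x≐y =
  cong₂ _∷_ (x≐y 0 z<s) (restrict-cong n λ j j<n → x≐y (suc j) (s<s j<n))

restrict-injective : ∀ {x y} n → restrict x n ≡ restrict y n → ∀ j → j < n → x j ≡ y j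
restrict-injective (suc n) eq zero    _         = ∷-injectiveˡ eq
restrict-injective (suc n) eq (suc j) (s≤s j<n) =
  restrict-injective n (∷-injectiveʳ eq) j j<n

restrict-≺ : ∀ x n → restrict x n ≺ x
restrict-≺ x n = cong (restrict x) (length-restrict x n)

restrict-≺⇒≡ : ∀ {x y} n → restrict x n ≺ y → ∀ j → j < n → y j ≡ x j
restrict-≺⇒≡ {x} {y} n x≺y =
  restrict-injective n (trans (cong (restrict y) (sym (length-restrict x n))) x≺y)

≺⇒≡ : ∀ {p x y} → p ≺ x → p ≺ y → ∀ j → j < length p → x j ≡ y j
≺⇒≡ {p} p≺x p≺y = restrict-injective (length p) (trans p≺x (sym p≺y))

≺-resp : ∀ {p x y} → (∀ j → j < length p → x j ≡ y j) → p ≺ x → p ≺ y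
≺-resp {p} x≡y p≺x = trans (sym (restrict-cong (length p) x≡y)) p≺x

⊑-≺ : ∀ {p q x} → p ⊑ q → q ≺ x → p ≺ x
⊑-≺ []           _   = refl
⊑-≺ (refl ∷ p⊑q) q≺x =
  cong₂ _∷_ (∷-injectiveˡ q≺x) (⊑-≺ p⊑q (∷-injectiveʳ q≺x))

≺⇒⊑restrict : ∀ {p x n} → p ≺ x → length p ≤ n → p ⊑ restrict x n
≺⇒⊑restrict {[]}    p≺x _        = []
≺⇒⊑restrict {b ∷ p} p≺x (s≤s le) =
  sym (∷-injectiveˡ p≺x) ∷ ≺⇒⊑restrict (∷-injectiveʳ p≺x) le

-- Overwriting in place instead of prepending leaves the tail unshifted, so the result stays
-- `E0`-equivalent to the point.
splice : List Bool → Cantor → Cantor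
splice []      x         = x
splice (b ∷ α) x zero    = b
splice (b ∷ α) x (suc j) = splice α (x ∘ suc) j

splice-≺ : ∀ α x → α ≺ splice α x
splice-≺ []      x = refl
splice-≺ (b ∷ α) x = cong (b ∷_) (splice-≺ α (x ∘ suc))

splice-tail : ∀ α x j → length α ≤ j → splice α x j ≡ x j
splice-tail []      x j       _         = refl
splice-tail (b ∷ α) x (suc j) (s≤s α≤j) = splice-tail α (x ∘ suc) j α≤j

splice-∷ʳ : ∀ x n b y → splice (restrict x n ∷ʳ b) y n ≡ b
splice-∷ʳ x zero    b y = refl
splice-∷ʳ x (suc n) b y = splice-∷ʳ (x ∘ suc) n b (y ∘ suc)

splice-∷ʳ-< : ∀ x n {b} y j → j < n → splice (restrict x n ∷ʳ b) y j ≡ x j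
splice-∷ʳ-< x (suc n) y zero    _         = refl
splice-∷ʳ-< x (suc n) y (suc j) (s≤s j<n) = splice-∷ʳ-< (x ∘ suc) n (y ∘ suc) j j<n

splice-drop-≺ : ∀ α {p x} → length α ≤ length p → p ≺ x → (α ++ drop (length α) p) ≺ splice α x
splice-drop-≺ []              _        p≺x = p≺x
splice-drop-≺ (b ∷ α) {c ∷ p} (s≤s le) p≺x =
  cong (b ∷_) (splice-drop-≺ α le (∷-injectiveʳ p≺x))

drop-++ : ∀ (α : List Bool) {p w : List Bool} → length α ≤ length p →
          drop (length α) (p ++ w) ≡ drop (length α) p ++ w
drop-++ []              _        = refl
drop-++ (b ∷ α) {c ∷ p} (s≤s le) = drop-++ α le

splice-E0 : ∀ α x → E0 (splice α x) x
splice-E0 α x = length α , λ k α<k → splice-tail α x k (<⇒≤ α<k)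

-- The dense open set D

D-open : IsOpen³ D
D-open (x , y , z) (n , x≢y , x≢z , y≢z) =
  (restrict x N , restrict y N , restrict z N) ,
  (restrict-≺ x N , restrict-≺ y N , restrict-≺ z N) ,
  λ (x′ , y′ , z′) (px , py , pz) →
    let at : ∀ x x′ → restrict x N ≺ x′ → ∀ j → j < N → x j ≡ x′ j
        at x x′ p j j<N = sym (restrict-≺⇒≡ {x} {x′} N p j j<N)
        n<N  = m<n⇒m<1+n (n<1+n n)
        sn<N = n<1+n (suc n)
    in n ,
       subst₂ _≢_ (at x x′ px n n<N) (at y y′ py n n<N) x≢y ,
       subst₂ _≢_ (at x x′ px n n<N) (at z z′ pz n n<N) x≢z ,
       subst₂ _≢_ (at y y′ py (suc n) sn<N) (at z z′ pz (suc n) sn<N) y≢z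
  -- A witness `n` reads positions up to `suc n` only.
  where N = suc (suc n)

D-dense : IsDense³ D
D-dense (σ , τ , ρ) =
  -- The third tail jumps from 0 to 1 right after `n`: at `n` the values are 1, 0, 0, and at `suc n`
  -- the last two are 0, 1.
  (splice σ (λ _ → true) , splice τ (λ _ → false) , splice ρ (λ j → n <ᵇ j)) ,
  (splice-≺ σ _ , splice-≺ τ _ , splice-≺ ρ _) ,
  n ,
  subst₂ _≢_ (sym xn) (sym (splice-tail τ _ n τ≤n)) (λ ()) ,
  subst₂ _≢_ (sym xn) (sym (trans (splice-tail ρ _ n ρ≤n) (n<ᵇn n))) (λ ()) ,
  subst₂ _≢_ (sym (splice-tail τ _ (suc n) (m≤n⇒m≤1+n τ≤n)))
             (sym (trans (splice-tail ρ _ (suc n) (m≤n⇒m≤1+n ρ≤n)) (n<ᵇ1+n n))) (λ ())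
  where
  n   = length σ ⊔ length τ ⊔ length ρ
  ρ≤n = m≤n⊔m (length σ ⊔ length τ) (length ρ)
  στ≤n = m≤m⊔n (length σ ⊔ length τ) (length ρ)
  τ≤n = ≤-trans (m≤n⊔m (length σ) (length τ)) στ≤n
  xn  = splice-tail σ (λ _ → true) n (≤-trans (m≤m⊔n (length σ) (length τ)) στ≤n)
  n<ᵇn : ∀ n → (n <ᵇ n) ≡ false
  n<ᵇn zero    = refl
  n<ᵇn (suc n) = n<ᵇn n
  n<ᵇ1+n : ∀ n → (n <ᵇ suc n) ≡ true
  n<ᵇ1+n zero    = refl
  n<ᵇ1+n (suc n) = n<ᵇ1+n n

-- Branches of E0-trees

≺-++ : ∀ u {w} {X : Cantor} → (u ++ w) ≺ X → u ≺ X × w ≺ (λ j → X (length u + j))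
≺-++ []      p = refl , p
≺-++ (b ∷ u) p with ≺-++ u (∷-injectiveʳ p)
... | q , r = cong₂ _∷_ (∷-injectiveˡ p) q , r

module _ (p : E0Tree) where
  open E0Tree p

  Branch : ℕ → Cantor → Cantor → Set
  Branch k x X = ∀ N → φ-from k (restrict x N) ≺ X

  private
    L : ℕ → ℕ
    L k = length (v k false)

  v-length : ∀ k b → length (v k b) ≡ L k
  v-length k false = refl
  v-length k true  = sym (v-len k)

  block-≺ : ∀ {k x X} → Branch k x X → v k (x 0) ≺ X
  block-≺ {k} {x} br = proj₁ (≺-++ (v k (x 0)) (br 1))

  Branch-tail : ∀ {k x X} → Branch k x X → Branch (suc k) (x ∘ suc) (λ j → X (L k + j))
  Branch-tail {k} {x} {X} br N =
    subst (λ l → φ-from (suc k) (restrict (x ∘ suc) N) ≺ (λ j → X (l + j)))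
          (v-length k (x 0)) (proj₂ (≺-++ (v k (x 0)) (br (suc N))))

  block-agree : ∀ {k x y X Y} → Branch k x X → Branch k y Y → x 0 ≡ y 0 →
                ∀ j → j < L k → X j ≡ Y j
  block-agree {k} {x} {y} {X} {Y} bx by eq j j<L =
    ≺⇒≡ {v k (y 0)} {X} {Y} (subst (λ b → v k b ≺ X) eq (block-≺ bx)) (block-≺ by) j
        (subst (j <_) (sym (v-length k (y 0))) j<L)

  L>0 : ∀ k → 0 < L k
  L>0 k with v k false | v-head k false
  ... | _ | w , refl = z<s

  -- If n is the last index of a block in which Y and Z agree, the heads of the next
  -- blocks decide: there both begin with y (suc i) ≡ z (suc i).
  branches∉D : ∀ n {k x y z X Y Z} → Branch k x X → Branch k y Y → Branch k z Z →
               (∀ i → x i ≡ y i ⊎ (y i ≡ z i × y (suc i) ≡ z (suc i))) →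
               ¬ (X n ≢ Y n × X n ≢ Z n × Y (suc n) ≢ Z (suc n))
  branches∉D = <-rec _ step
    where
    step : ∀ n → _ → _
    step n rec {k} {x} {y} {z} {X} {Y} {Z} bx by bz ok (X≢Y , X≢Z , Y≢Z) with n <? L k
    ... | yes n<L with ok 0
    ...   | inj₁ x≡y = X≢Y (block-agree bx by x≡y n n<L)
    ...   | inj₂ (y≡z , y′≡z′) with suc n <? L k
    ...     | yes sn<L = Y≢Z (block-agree by bz y≡z (suc n) sn<L)
    ...     | no  sn≮L = Y≢Z (subst (λ l → Y l ≡ Z l) (trans (+-identityʳ (L k)) (≤-antisym (≮⇒≥ sn≮L) n<L))
                          (block-agree (Branch-tail by) (Branch-tail bz) y′≡z′ 0 (L>0 (suc k))))
    step n rec {k} {x} {y} {z} {X} {Y} {Z} bx by bz ok (X≢Y , X≢Z , Y≢Z) | no n≮L =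
      -- Position `n` lies beyond the first block; dropping that block, which is nonempty, decreases
      -- `n`.
      rec {n ∸ L k} (∸-monoʳ-< (L>0 k) L≤n) (Branch-tail bx) (Branch-tail by) (Branch-tail bz)
          (ok ∘ suc)
          ( X≢Y ∘ subst (λ l → X l ≡ Y l) eq
          , X≢Z ∘ subst (λ l → X l ≡ Z l) eq
          , Y≢Z ∘ subst (λ l → Y l ≡ Z l) (trans (+-suc (L k) _) (cong suc eq)))
      where
      L≤n = ≮⇒≥ n≮L
      eq  = m+[n∸m]≡n L≤n

  Φ-tilde∉D : ∀ Φ → IsCanonicalMap p Φ →
              ¬ D (Φ (tilde (false ∷ true ∷ false ∷ [])) ,
                   Φ (tilde (true ∷ true ∷ false ∷ [])) ,
                   Φ (tilde (true ∷ [])))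
  Φ-tilde∉D Φ can (n , X≢Y , X≢Z , Y≢Z) with n <? length s
  ... | yes n<s = X≢Y (≺⇒≡ {s} {Φ x} {Φ y} (root x) (root y) n n<s)
    where
    x = tilde (false ∷ true ∷ false ∷ [])
    y = tilde (true ∷ true ∷ false ∷ [])
    root : ∀ x → s ≺ Φ x
    root x = proj₁ (≺-++ s (can x 0))
  ... | no n≮s =
    branches∉D (n ∸ length s) (branch x) (branch y) (branch z) alternatives
      ( X≢Y ∘ subst (λ l → Φ x l ≡ Φ y l) eq
      , X≢Z ∘ subst (λ l → Φ x l ≡ Φ z l) eq
      , Y≢Z ∘ subst (λ l → Φ y l ≡ Φ z l) (trans (+-suc (length s) _) (cong suc eq)))
    where
    x = tilde (false ∷ true ∷ false ∷ [])
    y = tilde (true ∷ true ∷ false ∷ [])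
    z = tilde (true ∷ [])
    eq = m+[n∸m]≡n (≮⇒≥ n≮s)
    branch : ∀ x → Branch 0 x (λ j → Φ x (length s + j))
    branch x N = proj₂ (≺-++ s (can x N))
    alternatives : ∀ i → x i ≡ y i ⊎ (y i ≡ z i × y (suc i) ≡ z (suc i))
    alternatives 0 = inj₂ (refl , refl)
    alternatives 1 = inj₁ refl
    alternatives 2 = inj₁ refl
    -- All three sequences are invariant under a shift by 3, and `mod` computes the shift away.
    alternatives (suc (suc (suc i))) = alternatives i

-- Reductions of E0 into sets whose triples lie in D

≐-sym : ∀ {x y} → x ≐ y → y ≐ x
≐-sym x≐y j = sym (x≐y j)

≺-≐ : ∀ {x y} p → x ≐ y → p ≺ x → p ≺ y
≺-≐ {x} {y} p x≐y = ≺-resp {p} {x} {y} (λ j _ → x≐y j)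

⟦⟧-resp : ∀ c {x y} → x ≐ y → ⟦ c ⟧ x → ⟦ c ⟧ y
⟦⟧-resp (basic σ) x≐y σ≺x     = ≺-≐ σ x≐y σ≺x
⟦⟧-resp (compl c) x≐y x∉c     = x∉c ∘ ⟦⟧-resp c (≐-sym x≐y)
⟦⟧-resp (union g) x≐y (i , x∈g) = i , ⟦⟧-resp (g i) x≐y x∈g

-- `f-D` combines two facts: inequivalent points have inequivalent images, and inequivalent triples
-- of the target set lie in `D`.
record D-Reduction : Set where
  field
    f      : Cantor → Cantor
    code   : List Bool → BorelCode
    ≺⇒code : ∀ σ x → σ ≺ f x → ⟦ code σ ⟧ x
    code⇒≺ : ∀ σ x → ⟦ code σ ⟧ x → σ ≺ f x
    f-E0   : ∀ {a b} → E0 a b → E0 (f a) (f b)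
    f-D    : ∀ {a b c} → ¬ E0 a b → ¬ E0 a c → ¬ E0 b c → D (f a , f b , f c)

  -- Borel codes cannot tell pointwise equal points apart, and the codes of all `σ` determine `f x`.
  f-cong : ∀ {x y} → x ≐ y → f x ≐ f y
  f-cong {x} {y} x≐y j = sym (restrict-≺⇒≡ {f x} {f y} (suc j) σ≺fy j (n<1+n j))
    where
    σ≺fy : restrict (f x) (suc j) ≺ f y
    σ≺fy = code⇒≺ _ y (⟦⟧-resp (code _) x≐y (≺⇒code _ x (restrict-≺ (f x) (suc j))))

-- Discontinuity and the weak limited principle of omniscience

WLPO : Set
WLPO = ∀ (α : ℕ → Bool) → Dec (∀ n → α n ≡ false)

-- Bounded search for the first `true`, with the bound itself as default; hence the value `m ⊓ k`
-- once a first place `m` exists.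
μ< : (ℕ → Bool) → ℕ → ℕ
μ< α zero    = zero
μ< α (suc k) with α 0
... | true  = zero
... | false = suc (μ< (α ∘ suc) k)

μ<-none : ∀ α → (∀ n → α n ≡ false) → ∀ k → μ< α k ≡ k
μ<-none α none zero    = refl
μ<-none α none (suc k) rewrite none 0 = cong suc (μ<-none (α ∘ suc) (none ∘ suc) k)

μ<-some : ∀ α n → α n ≡ true → ∃[ m ] (∀ k → μ< α k ≡ m ⊓ k)
μ<-some α n αn with α 0 in α0
μ<-some α n       αn | true = 0 , λ { zero → refl ; (suc k) → at0 k }
  where
  at0 : ∀ k → μ< α (suc k) ≡ 0
  at0 k rewrite α0 = refl
μ<-some α zero    αn | false = case trans (sym α0) αn of λ ()
μ<-some α (suc n) αn | false with μ<-some (α ∘ suc) n αn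
... | m , μ≡ = suc m , λ { zero → refl ; (suc k) → at-suc k }
  where
  at-suc : ∀ k → μ< α (suc k) ≡ suc (m ⊓ k)
  at-suc k rewrite α0 = cong suc (μ≡ k)

-- Grilliot's trick: the point y below follows p∞ until α fires, and E y decides
-- whether this ever happens.
grilliot : (E : Cantor → Set) → (∀ y → Dec (E y)) → (∀ {y z} → y ≐ z → E y → E z) →
           (p : ℕ → Cantor) (p∞ : Cantor) → (∀ u j → j < u → p u j ≡ p∞ j) →
           E p∞ → (∀ u → ¬ E (p u)) → WLPO
grilliot E E? E-resp p p∞ conv Ep∞ ¬Ep α = decide (E? y)
  where
  y : Cantor
  y j = p (μ< α (suc j)) j

  none⇒y≐p∞ : (∀ n → α n ≡ false) → y ≐ p∞
  none⇒y≐p∞ none j rewrite μ<-none α none (suc j) = conv (suc j) j (n<1+n j)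

  some⇒y≐p : ∀ {n} → α n ≡ true → ∃[ m ] (y ≐ p m)
  some⇒y≐p {n} αn with μ<-some α n αn
  ... | m , μ≡ = m , λ j → trans (cong (λ u → p u j) (μ≡ (suc j))) (at j)
    where
    at : ∀ j → p (m ⊓ suc j) j ≡ p m j
    at j with j <? m
    ... | yes j<m = trans (cong (λ u → p u j) (m≥n⇒m⊓n≡n j<m))
                          (trans (conv (suc j) j (n<1+n j)) (sym (conv m j j<m)))
    ... | no  j≮m = cong (λ u → p u j) (m≤n⇒m⊓n≡m (m≤n⇒m≤1+n (≮⇒≥ j≮m)))

  decide : Dec (E y) → Dec (∀ n → α n ≡ false)
  decide (yes Ey) = yes λ n → ¬-not λ αn →
    let (m , y≐p) = some⇒y≐p αn in ¬Ep m (E-resp y≐p Ey)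
  decide (no ¬Ey) = no λ none → ¬Ey (E-resp (≐-sym (none⇒y≐p∞ none)) Ep∞)

-- Two players, indexed by Bool, modify the base point x in turn; beyond bound the
-- images of both current points agree with f x.
record State : Set where
  field
    pt    : Bool → Cantor
    turn  : Bool
    bound : ℕ

open State

-- The alternating game around a base point

module Game (R : D-Reduction) (x : Cantor) where
  open D-Reduction R

  start : State
  start = record { pt = λ _ → x ; turn = true ; bound = 0 }

  act : State → List Bool → State
  act S α = record
    { pt    = λ b → if-turn b (b Bool.≟ turn S)
    ; turn  = not (turn S)
    -- `E0` gives agreement strictly beyond its witness, whence `suc`; this also makes bounds
    -- strictly increase.
    ; bound = suc (bound S ⊔ proj₁ (f-E0 (splice-E0 α x)))
    }
    where
    if-turn : ∀ b → Dec (b ≡ turn S) → Cantor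
    if-turn b (yes _) = splice α x
    if-turn b (no  _) = pt S b

  act-turn : ∀ S α → pt (act S α) (turn S) ≡ splice α x
  act-turn S α with turn S Bool.≟ turn S
  ... | yes _  = refl
  ... | no b≢b = ⊥-elim (b≢b refl)

  act-other : ∀ S α {b} → b ≢ turn S → pt (act S α) b ≡ pt S b
  act-other S α {b} b≢ with b Bool.≟ turn S
  ... | yes b≡ = ⊥-elim (b≢ b≡)
  ... | no  _  = refl

  -- For different players, `apart` excludes a deviation of one right before a deviation of the
  -- other, the pattern that `D` demands of `(f a , f x , f c)`.
  record Separated (S : State) : Set where
    field
      agree : ∀ b n → bound S ≤ n → f (pt S b) n ≡ f x n
      apart : ∀ b c m → f (pt S b) m ≢ f x m → f (pt S c) (suc m) ≢ f x (suc m) → b ≡ c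

  open Separated

  start-Separated : Separated start
  start-Separated = record { agree = λ _ _ _ → refl ; apart = λ _ _ _ x≢x → ⊥-elim (x≢x refl) }

  -- An admissible move keeps the image up to and including bound, so the new
  -- deviations from f x of one player stay at distance from those of the other.
  Admissible : State → List Bool → Set
  Admissible S α = ∀ {n} → n < suc (bound S) → f (splice α x) n ≡ f (pt S (turn S)) n

  admissible? : ∀ S α → Dec (Admissible S α)
  admissible? S α = allUpTo? (λ n → f (splice α x) n Bool.≟ f (pt S (turn S)) n) (suc (bound S))

  act-preserves : ∀ S {α} → Admissible S α → ∀ b {n} → n ≤ bound S →
                  f (pt (act S α) b) n ≡ f (pt S b) n
  act-preserves S adm b n≤ with b Bool.≟ turn S
  ... | yes refl = adm (s≤s n≤)
  ... | no  _    = refl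

  bound-act : ∀ S α → bound S < bound (act S α)
  bound-act S α = s≤s (m≤m⊔n (bound S) _)

  act-Separated : ∀ S {α} → Separated S → Admissible S α → Separated (act S α)
  act-Separated S {α} inv adm = record { agree = agree′ ; apart = apart′ }
    where
    y = splice α x

    agree′ : ∀ b n → bound (act S α) ≤ n → f (pt (act S α) b) n ≡ f x n
    agree′ b n bd≤n with b Bool.≟ turn S
    ... | yes _ = proj₂ (f-E0 (splice-E0 α x)) n (≤-trans (s≤s (m≤n⊔m (bound S) _)) bd≤n)
    ... | no  _ = agree inv b n (<⇒≤ (≤-trans (s≤s (m≤m⊔n (bound S) _)) bd≤n))

    below : ∀ b {n} → f (pt S b) n ≢ f x n → n < bound S
    below b ≢x = ≰⇒> (λ bd≤n → ≢x (agree inv b _ bd≤n))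

    apart′ : ∀ b c m → f (pt (act S α) b) m ≢ f x m →
             f (pt (act S α) c) (suc m) ≢ f x (suc m) → b ≡ c
    apart′ b c m ≢b ≢c with b Bool.≟ turn S | c Bool.≟ turn S
    ... | yes refl | yes refl = refl
    ... | no _     | no _     = apart inv b c m ≢b ≢c
    -- One player has moved. The other's deviation lies below `bound S`, so the mover's adjacent
    -- position is at most `bound S`, where admissibility keeps the old image.
    ... | yes refl | no _     = apart inv b c m (≢b ∘ trans (adm (s≤s (<⇒≤ (<-trans (n<1+n m) (below c ≢c)))))) ≢c
    ... | no _     | yes refl = apart inv b c m ≢b (≢c ∘ trans (adm (s≤s (below b ≢b))))

  -- The common end of both cases: `diff` makes `Y true`, `x`, `Y false` pairwise inequivalent, and
  -- the resulting witness for `D` involves finitely many positions, so it already contradicts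
  -- `apart` in some state. Double negations suffice, the goal being `⊥`.
  limits-absurd : (Y : Bool → Cantor) →
    (∀ n → ¬ ¬ (∃[ S ] (Separated S × (∀ b m → m ≤ n → f (Y b) m ≡ f (pt S b) m)))) →
    (∀ b n → ¬ ¬ (∃[ j ] (n < j × Y b j ≢ x j × Y (not b) j ≡ x j))) → ⊥
  limits-absurd Y approx diff with f-D {Y true} {x} {Y false} (Y≁x true) (Y≁Y true)
                                   (λ { (n , x≡Y) → Y≁x false (n , λ k n<k → sym (x≡Y k n<k)) })
    where
    Y≁x : ∀ b → ¬ E0 (Y b) x
    Y≁x b (n , Y≡x) = diff b n λ (j , n<j , Y≢x , _) → Y≢x (Y≡x j n<j)
    Y≁Y : ∀ b → ¬ E0 (Y b) (Y (not b))
    Y≁Y b (n , Y≡Y) = diff b n λ (j , n<j , Y≢x , Y′≡x) → Y≢x (trans (Y≡Y j n<j) Y′≡x)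
  ... | n , t≢x , _ , x≢f = approx (suc n) λ (S , inv , eq) →
    case apart inv true false n
           (λ e → t≢x (trans (eq true n (n≤1+n n)) e))
           (λ e → x≢f (sym (trans (eq false (suc n) ≤-refl) e))) of λ ()

-- The case where WLPO fails

-- The search for the next move cannot be carried out, so the points are produced
-- bit by bit: at time t the acting player tries to put 1 at position t, and pads
-- with 0 as long as the (decidable) admissibility test fails.
module ¬WLPO-absurd (R : D-Reduction) (¬wlpo : ¬ WLPO) where
  open D-Reduction R

  0ω : Cantor
  0ω _ = false

  open Game R 0ω

  trial : State → ℕ → List Bool
  trial S t = restrict (pt S (turn S)) t ∷ʳ true

  step : State → ℕ → State
  step S t with admissible? S (trial S t)
  ... | yes _ = act S (trial S t)
  ... | no  _ = S

  run : ℕ → State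
  run zero    = start
  run (suc t) = step (run t) t

  Success : ℕ → Set
  Success t = Admissible (run t) (trial (run t) t)

  step-success : ∀ S t → Admissible S (trial S t) → step S t ≡ act S (trial S t)
  step-success S t adm with admissible? S (trial S t)
  ... | yes _    = refl
  ... | no ¬adm  = ⊥-elim (¬adm adm)

  step-failure : ∀ S t → ¬ Admissible S (trial S t) → step S t ≡ S
  step-failure S t ¬adm with admissible? S (trial S t)
  ... | yes adm = ⊥-elim (¬adm adm)
  ... | no _    = refl

  -- If all trials from `t` on failed, the state would freeze and the trial points would converge to
  -- the current point while their images differ from its image below a fixed bound: a
  -- discontinuity.
  stuck : ∀ t → ¬ (∀ d → ¬ Success (d + t))
  stuck t fail = ¬wlpo (grilliot E (λ y → allUpTo? (λ n → f y n Bool.≟ f a n) _)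
                          (λ y≐z Ey n<k → trans (sym (f-cong y≐z _)) (Ey n<k))
                          (λ d → splice (trial S (d + t)) 0ω) a
                          (λ d j j<d → splice-∷ʳ-< a (d + t) 0ω j (≤-trans j<d (m≤m+n d t)))
                          (λ _ → refl)
                          (λ d → subst (λ S′ → ¬ Admissible S′ (trial S′ (d + t))) (same d) (fail d)))
    where
    S = run t
    a = pt S (turn S)
    E : Cantor → Set
    E y = ∀ {n} → n < suc (bound S) → f y n ≡ f a n
    same : ∀ d → run (d + t) ≡ S
    same zero    = refl
    same (suc d) = trans (step-failure (run (d + t)) (d + t) (fail d)) (same d)

  success : ∀ t → ¬ ¬ (∃[ d ] Success (d + t))
  success t none = stuck t λ d s → none (d , s)

  run-Separated : ∀ t → Separated (run t)
  run-Separated zero    = start-Separated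
  run-Separated (suc t) with admissible? (run t) (trial (run t) t)
  ... | yes adm = act-Separated (run t) (run-Separated t) adm
  ... | no  _   = run-Separated t

  bound-suc : ∀ t → bound (run t) ≤ bound (run (suc t))
  bound-suc t with admissible? (run t) (trial (run t) t)
  ... | yes _ = <⇒≤ (bound-act (run t) (trial (run t) t))
  ... | no  _ = ≤-refl

  bound-mono : ∀ d t → bound (run t) ≤ bound (run (d + t))
  bound-mono zero    t = ≤-refl
  bound-mono (suc d) t = ≤-trans (bound-mono d t) (bound-suc (d + t))

  preserved-suc : ∀ t b {n} → n ≤ bound (run t) → f (pt (run (suc t)) b) n ≡ f (pt (run t) b) n
  preserved-suc t b n≤ with admissible? (run t) (trial (run t) t)
  ... | yes adm = act-preserves (run t) adm b n≤
  ... | no  _   = refl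

  preserved : ∀ d t b {n} → n ≤ bound (run t) → f (pt (run (d + t)) b) n ≡ f (pt (run t) b) n
  preserved zero    t b n≤ = refl
  preserved (suc d) t b n≤ =
    trans (preserved-suc (d + t) b (≤-trans n≤ (bound-mono d t))) (preserved d t b n≤)

  old-bits-suc : ∀ t b j → j < t → pt (run (suc t)) b j ≡ pt (run t) b j
  old-bits-suc t b j j<t with admissible? (run t) (trial (run t) t)
  ... | no  _ = refl
  ... | yes _ with b Bool.≟ turn (run t)
  ...   | yes refl = splice-∷ʳ-< (pt (run t) b) t 0ω j j<t
  ...   | no  _    = refl

  old-bits : ∀ d t b j → j < t → pt (run (d + t)) b j ≡ pt (run t) b j
  old-bits zero    t b j j<t = refl
  old-bits (suc d) t b j j<t =
    trans (old-bits-suc (d + t) b j (≤-trans j<t (m≤n+m t d))) (old-bits d t b j j<t)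

  new-bits : ∀ t b j → t ≤ j → pt (run t) b j ≡ false
  new-bits zero    b j _ = refl
  new-bits (suc t) b j t<j with admissible? (run t) (trial (run t) t)
  ... | no  _ = new-bits t b j (<⇒≤ t<j)
  ... | yes _ with b Bool.≟ turn (run t)
  ...   | yes _ = splice-tail (trial (run t) t) 0ω j (≤-trans (≤-reflexive length-trial) t<j)
    where
    length-trial : length (trial (run t) t) ≡ suc t
    length-trial = trans (length-++ (restrict (pt (run t) (turn (run t))) t))
                         (trans (+-comm _ 1) (cong suc (length-restrict _ t)))
  ...   | no  _ = new-bits t b j (<⇒≤ t<j)

  -- The pointwise limit: bit `j` is final from time `suc j` on.
  Y : Bool → Cantor
  Y b j = pt (run (suc j)) b j

  Y-bits : ∀ t b j → j < t → Y b j ≡ pt (run t) b j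
  Y-bits t b j j<t = sym (trans (cong (λ u → pt (run u) b j) (sym (m∸n+n≡m j<t)))
                                (old-bits (t ∸ suc j) (suc j) b j (n<1+n j)))

  -- The value at `n` is constant along the later stages, so a different value at the limit would be
  -- a discontinuity at `Y b`.
  f-Y : ∀ t b n → n ≤ bound (run t) → f (Y b) n ≡ f (pt (run t) b) n
  f-Y t b n n≤ with f (pt (run t) b) n Bool.≟ f (Y b) n
  ... | yes eq = sym eq
  ... | no  ≢  = ⊥-elim (¬wlpo (grilliot (λ y → f y n ≡ f (Y b) n) (λ y → f y n Bool.≟ f (Y b) n)
                   (λ y≐z → trans (sym (f-cong y≐z n)))
                   (λ d → pt (run (d + t)) b) (Y b)
                   (λ d j j<d → sym (Y-bits (d + t) b j (≤-trans j<d (m≤m+n d t))))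
                   refl
                   (λ d → ≢ ∘ trans (sym (preserved d t b n≤)))))

  bound-unbounded : ∀ n → ¬ ¬ (∃[ t ] n ≤ bound (run t))
  bound-unbounded zero    none = none (0 , z≤n)
  bound-unbounded (suc n) none = bound-unbounded n λ (t , n≤) → success t λ (d , s) →
    none (suc (d + t) , ≤-trans (s≤s (≤-trans n≤ (bound-mono d t)))
      (subst (λ S → bound (run (d + t)) < bound S) (sym (step-success (run (d + t)) (d + t) s))
             (bound-act (run (d + t)) (trial (run (d + t)) (d + t)))))

  -- If `b` never succeeded after `n`, it could not be on turn after `n` either, as it would be
  -- stuck; yet any success of the other player puts `b` on turn.
  alternate : ∀ b n → ¬ ¬ (∃[ t ] (n < t × Success t × turn (run t) ≡ b))
  alternate b n none = success (suc n) λ (d , s) → fail (d + suc n) (m≤n+m (suc n) d) s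
    where
    not-b : ∀ t → n < t → turn (run t) ≢ b
    not-b t n<t t≡b = stuck t λ d s →
      none (d + t , ≤-trans n<t (m≤n+m t d) , s , trans (cong turn (same d)) t≡b)
      where
      same : ∀ d → run (d + t) ≡ run t
      same zero    = refl
      same (suc d) = trans (step-failure (run (d + t)) (d + t) λ s →
        none (d + t , ≤-trans n<t (m≤n+m t d) , s , trans (cong turn (same d)) t≡b)) (same d)
    fail : ∀ t → n < t → ¬ Success t
    fail t n<t s = not-b (suc t) (m<n⇒m<1+n n<t)
      (trans (cong turn (step-success (run t) t s))
             (sym (¬-not (not-b t n<t ∘ sym))))

  absurd : ⊥
  absurd = limits-absurd Y
    (λ n none → bound-unbounded n λ (t , n≤) →
      none (run t , run-Separated t , λ b m m≤n → f-Y t b m (≤-trans m≤n n≤)))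
    (λ b n none → alternate b n λ (t , n<t , s , t≡b) →
      none (t , n<t , differs t s b t≡b))
    where
    differs : ∀ t → Success t → ∀ b → turn (run t) ≡ b → Y b t ≢ false × Y (not b) t ≡ false
    differs t s b refl = (λ Y≡ → case trans (sym Y-self) Y≡ of λ ()) , Y-other
      where
      S = run t
      Y-self : Y b t ≡ true
      Y-self = trans (cong (λ S′ → pt S′ b t) (step-success S t s))
              (trans (cong (λ y → y t) (act-turn S (trial S t)))
                     (splice-∷ʳ (pt S b) t true 0ω))
      Y-other : Y (not b) t ≡ false
      Y-other = trans (cong (λ S′ → pt S′ (not b) t) (step-success S t s))
               (trans (cong (λ y → y t) (act-other S (trial S t) (λ e → not-¬ refl (sym e))))
                      (new-bits t (not b) t ≤-refl))

-- Enumerations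

-- Bijective base-2 numeration
enum : ℕ → List Bool
enum zero    = []
enum (suc n) = increment (enum n)
  where
  increment : List Bool → List Bool
  increment []          = false ∷ []
  increment (false ∷ p) = true ∷ p
  increment (true ∷ p)  = false ∷ increment p

index : List Bool → ℕ
index []          = 0
index (false ∷ p) = suc (index p + index p)
index (true ∷ p)  = suc (suc (index p + index p))

enum-odd : ∀ n → enum (suc (n + n)) ≡ false ∷ enum n
enum-odd zero    = refl
enum-odd (suc n) rewrite +-suc n n | enum-odd n = refl

enum-index : ∀ p → enum (index p) ≡ p
enum-index []          = refl
enum-index (false ∷ p) = trans (enum-odd (index p)) (cong (false ∷_) (enum-index p))
enum-index (true ∷ p)  rewrite enum-odd (index p) = cong (true ∷_) (enum-index p)

-- A number is a run of `true` closed by `false`; an unclosed final run is dropped, so every string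
-- codes a list.
unary : List Bool → List ℕ
unary []          = []
unary (false ∷ p) = 0 ∷ unary p
unary (true ∷ p)  = bump (unary p)
  where
  bump : List ℕ → List ℕ
  bump []       = []
  bump (n ∷ ns) = suc n ∷ ns

unary⁻¹ : List ℕ → List Bool
unary⁻¹ []       = []
unary⁻¹ (n ∷ ns) = replicate n true ++ false ∷ unary⁻¹ ns

unary-unary⁻¹ : ∀ ns → unary (unary⁻¹ ns) ≡ ns
unary-unary⁻¹ []             = refl
unary-unary⁻¹ (zero ∷ ns)    = cong (0 ∷_) (unary-unary⁻¹ ns)
unary-unary⁻¹ (suc n ∷ ns)   rewrite unary-unary⁻¹ (n ∷ ns) = refl

enumℕ* : ℕ → List ℕ
enumℕ* n = unary (enum n)

indexℕ* : List ℕ → ℕ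
indexℕ* ns = index (unary⁻¹ ns)

enumℕ*-index : ∀ ns → enumℕ* (indexℕ* ns) ≡ ns
enumℕ*-index ns = trans (cong unary (enum-index (unary⁻¹ ns))) (unary-unary⁻¹ ns)

-- A negative answer yields no counterexample, only the impossibility of there being none.
Searchable : Set → Set₁
Searchable A = ∀ {P : A → Set} → (∀ a → Dec (P a)) → Dec (∀ a → P a)

WLPO⇒Searchable : WLPO → Searchable ℕ
WLPO⇒Searchable wlpo {P} P? with wlpo (λ n → not (does (P? n)))
... | yes all = yes λ n → from n (P? n) (all n)
  where
  from : ∀ n (d : Dec (P n)) → not (does d) ≡ false → P n
  from n (yes p) _ = p
... | no ¬all = no λ all → ¬all λ n → cong not (dec-true (P? n) (all n))

Searchable-enum : ∀ {A : Set} (e : ℕ → A) (i : A → ℕ) → (∀ a → e (i a) ≡ a) →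
                  Searchable ℕ → Searchable A
Searchable-enum e i ei search {P} P? with search (P? ∘ e)
... | yes all = yes λ a → subst P (ei a) (all (i a))
... | no ¬all = no λ all → ¬all (all ∘ e)

all-Bool? : Searchable Bool
all-Bool? P? with P? true | P? false
... | yes t | yes f = yes λ { true → t ; false → f }
... | no ¬t | _     = no λ all → ¬t (all true)
... | _     | no ¬f = no λ all → ¬f (all false)

-- Cohen forcing for Borel codes

-- The union clause is a negated universal so that a search over `ℕ` can decide it.
Forces : BorelCode → List Bool → Set
Forces (basic σ) p = σ ⊑ p
Forces (compl c) p = ∀ q → p ⊑ q → ¬ Forces c q
Forces (union g) p = ¬ (∀ i → ¬ Forces (g i) p)

Forces-⊑ : ∀ c {p q} → p ⊑ q → Forces c p → Forces c q
Forces-⊑ (basic σ) p⊑q σ⊑p      = ⊑-trans σ⊑p p⊑q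
Forces-⊑ (compl c) p⊑q ⊩ r q⊑r  = ⊩ r (⊑-trans p⊑q q⊑r)
Forces-⊑ (union g) p⊑q ⊩ none   = ⊩ λ i → none i ∘ Forces-⊑ (g i) p⊑q

Decided : BorelCode → List Bool → Set
Decided c p = Forces c p ⊎ Forces (compl c) p

Decided-⊑ : ∀ c {p q} → p ⊑ q → Decided c p → Decided c q
Decided-⊑ c p⊑q (inj₁ ⊩) = inj₁ (Forces-⊑ c p⊑q ⊩)
Decided-⊑ c p⊑q (inj₂ ⊩) = inj₂ (Forces-⊑ (compl c) p⊑q ⊩)

-- If no extension of `p` forces `c`, then `p` itself forces `compl c`.
Decided-dense : ∀ c p → ¬ ¬ (∃[ w ] Decided c (p ++ w))
Decided-dense c p none = none ([] , inj₂ λ q p⊑q ⊩ →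
  let (w , q≡) = ⊑⇒++ (⊑-trans (⊑-refl ++ᵖ []) p⊑q) in
  none (w , inj₁ (subst (Forces c) q≡ ⊩)))

-- Subcodes addressed by paths. Any number steps below a complement and a path stops at a leaf,
-- which makes every list an address.
descendant : BorelCode → List ℕ → BorelCode
descendant c         []       = c
descendant (basic σ) (_ ∷ _)  = basic σ
descendant (compl c) (_ ∷ ns) = descendant c ns
descendant (union g) (n ∷ ns) = descendant (g n) ns

Generic : BorelCode → Cantor → Set
Generic c x = ∀ ns → ¬ ¬ (∃[ p ] (p ≺ x × Decided (descendant c ns) p))

common-extension : ∀ x p q → p ≺ x → q ≺ x → ∃[ r ] (r ≺ x × p ⊑ r × q ⊑ r)
common-extension x p q p≺x q≺x =
  restrict x n , restrict-≺ x n ,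
  ≺⇒⊑restrict p≺x (m≤m⊔n (length p) (length q)) ,
  ≺⇒⊑restrict q≺x (m≤n⊔m (length p) (length q))
  where n = length p ⊔ length q

mutual
  -- Half of the forcing theorem. For a complement, a prefix deciding `c` cannot force `c`, by the
  -- other half, hence forces `compl c`.
  ⟦⟧⇒Forces : ∀ c x → Generic c x → ⟦ c ⟧ x → ¬ ¬ (∃[ p ] (p ≺ x × Forces c p))
  ⟦⟧⇒Forces (basic σ) x gen σ≺x none = none (σ , σ≺x , ⊑-refl)
  ⟦⟧⇒Forces (compl c) x gen x∉c none = gen [] λ where
    (p , p≺x , inj₁ ⊩) → none (p , p≺x , ⊩)
    (p , p≺x , inj₂ ⊩) → gen (0 ∷ []) λ where
      (q , q≺x , inj₁ ⊩c) → Forces⇒⟦⟧ c x (gen ∘ (0 ∷_)) q q≺x ⊩c x∉c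
      (q , q≺x , inj₂ ⊩¬c) → none (q , q≺x , ⊩¬c)
  ⟦⟧⇒Forces (union g) x gen (i , x∈g) none =
    ⟦⟧⇒Forces (g i) x (gen ∘ (i ∷_)) x∈g λ (p , p≺x , ⊩) → none (p , p≺x , λ ¬⊩ → ¬⊩ i ⊩)

  -- The other half: prefixes of `x` forcing `c` and `compl c` would have a common extension.
  Forces⇒⟦⟧ : ∀ c x → Generic c x → ∀ p → p ≺ x → Forces c p → ¬ ¬ ⟦ c ⟧ x
  Forces⇒⟦⟧ (basic σ) x gen p p≺x σ⊑p x∉ = x∉ (⊑-≺ σ⊑p p≺x)
  Forces⇒⟦⟧ (compl c) x gen p p≺x ⊩ x∉ = x∉ λ x∈c →
    ⟦⟧⇒Forces c x (gen ∘ (0 ∷_)) x∈c λ (q , q≺x , ⊩c) →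
      let (r , _ , p⊑r , q⊑r) = common-extension x p q p≺x q≺x in
      ⊩ r p⊑r (Forces-⊑ c q⊑r ⊩c)
  Forces⇒⟦⟧ (union g) x gen p p≺x ⊩ x∉ = ⊩ λ i ⊩g →
    Forces⇒⟦⟧ (g i) x (gen ∘ (i ∷_)) p p≺x ⊩g λ x∈g → x∉ (i , x∈g)

-- Without Markov's principle a move that exists only up to ¬¬ cannot be computed, so
-- runs are only known to exist up to ¬¬; as least moves are unique, the bits of the
-- limit of all runs are nevertheless decidable.
module Histories (search : Searchable ℕ)
                 (Good : List ℕ → ℕ → Set) (good? : ∀ h n → Dec (Good h n)) where

  Least : List ℕ → ℕ → Set
  Least h n = Good h n × (∀ {m} → m < n → ¬ Good h m)

  least? : ∀ h n → Dec (Least h n)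
  least? h n = good? h n ×-dec allUpTo? (λ m → ¬? (good? h m)) n

  Least-unique : ∀ h {m n} → Least h m → Least h n → m ≡ n
  Least-unique h {m} {n} (gm , lm) (gn , ln) =
    ≤-antisym (≮⇒≥ λ n<m → lm n<m gn) (≮⇒≥ λ m<n → ln m<n gm)

  Good⇒Least : ∀ h → ¬ ¬ (∃[ n ] Good h n) → ¬ ¬ (∃[ n ] Least h n)
  Good⇒Least h ex none = ex λ (n , g) → <-rec (λ n → ¬ Good h n)
    (λ n rec g → none (n , g , λ m<n → rec m<n)) n g

  Run : List ℕ → Set
  Run []      = ⊤
  Run (n ∷ h) = Run h × Least h n

  run? : ∀ h → Dec (Run h)
  run? []      = yes tt
  run? (n ∷ h) = run? h ×-dec least? h n

  Run-unique : ∀ h h′ → Run h → Run h′ → length h ≡ length h′ → h ≡ h′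
  Run-unique []      []        _        _          _  = refl
  Run-unique (n ∷ h) (n′ ∷ h′) (r , l) (r′ , l′) eq with Run-unique h h′ r r′ (suc-injective eq)
  ... | refl = cong (_∷ h) (Least-unique h l l′)

  Run-extend : (∀ h → Run h → ¬ ¬ (∃[ n ] Good h n)) →
               ∀ h → Run h → ¬ ¬ (∃[ n ] Run (n ∷ h))
  Run-extend progress h r none = Good⇒Least h (progress h r) λ (n , l) → none (n , r , l)

  Run-exists : (∀ h → Run h → ¬ ¬ (∃[ n ] Good h n)) →
               ∀ i → ¬ ¬ (∃[ h ] (length h ≡ i × Run h))
  Run-exists progress zero    none = none ([] , refl , tt)
  Run-exists progress (suc i) none = Run-exists progress i λ (h , len , r) →
    Run-extend progress h r λ (n , r′) → none (n ∷ h , cong suc len , r′)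

  all-ℕ*? : Searchable (List ℕ)
  all-ℕ*? = Searchable-enum enumℕ* indexℕ* enumℕ*-index search

  module Limit (ρ : List ℕ → List Bool)
               (ρ-mono : ∀ h n → Run (n ∷ h) → ρ h ⊑ ρ (n ∷ h)) where

    -- With `false` as padding, a `true` bit can only come from within `ρ h`.
    bit : List ℕ → ℕ → Bool
    bit h = splice (ρ h) (λ _ → false)

    never-true? : ∀ j → Dec (∀ h → ¬ (Run h × bit h j ≡ true))
    never-true? j = all-ℕ*? λ h → ¬? (run? h ×-dec (bit h j Bool.≟ true))

    limit : Cantor
    limit j = not (does (never-true? j))

    ρ-≤ : ∀ h h′ → Run h → Run h′ → length h ≤ length h′ → ρ h ⊑ ρ h′
    ρ-≤ h h′ r r′ len with m≤n⇒m<n∨m≡n len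
    ρ-≤ h h′       r r′       len | inj₂ eq with Run-unique h h′ r r′ eq
    ... | refl = ⊑-refl
    ρ-≤ h (n ∷ h′) r (r′ , l) len | inj₁ (s≤s lt) = ⊑-trans (ρ-≤ h h′ r r′ lt) (ρ-mono h′ n (r′ , l))

    ⊑-bit : ∀ h h′ → ρ h ⊑ ρ h′ → ∀ j → j < length (ρ h) → bit h j ≡ bit h′ j
    ⊑-bit h h′ sub j j< =
      ≺⇒≡ {ρ h} {bit h} {bit h′} (splice-≺ (ρ h) _) (⊑-≺ sub (splice-≺ (ρ h′) _)) j j<

    true-bit : ∀ h h′ → Run h → Run h′ → ∀ j → j < length (ρ h) → bit h′ j ≡ true → bit h j ≡ true
    true-bit h h′ r r′ j j< eq with ≤-total (length h) (length h′)
    ... | inj₁ le = trans (⊑-bit h h′ (ρ-≤ h h′ r r′ le) j j<) eq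
    ... | inj₂ le with j <? length (ρ h′)
    ...   | yes j<′ = trans (sym (⊑-bit h′ h (ρ-≤ h′ h r′ r le) j j<′)) eq
    ...   | no  j≮  = case trans (sym eq) (splice-tail (ρ h′) _ j (≮⇒≥ j≮)) of λ ()

    bit-limit : ∀ h → Run h → ∀ j → j < length (ρ h) → bit h j ≡ limit j
    bit-limit h r j j< with never-true? j
    ... | yes never = ¬-not λ eq → never h (r , eq)
    ... | no ¬never = decidable-stable (bit h j Bool.≟ true) λ bit≢ →
      ¬never λ h′ (r′ , eq) → bit≢ (true-bit h h′ r r′ j j< eq)

    ρ-≺-limit : ∀ h → Run h → ρ h ≺ limit
    ρ-≺-limit h r = ≺-resp {ρ h} {bit h} {limit} (bit-limit h r) (splice-≺ (ρ h) _)

-- Deciding the forcing relation and building generic points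

module Forcing (search : Searchable ℕ) where

  all-strings? : Searchable (List Bool)
  all-strings? = Searchable-enum enum index enum-index search

  forces? : ∀ c p → Dec (Forces c p)
  forces? (basic σ) p = σ ⊑? p
  forces? (compl c) p = all-strings? λ q → (p ⊑? q) →-dec ¬? (forces? c q)
  forces? (union g) p = ¬? (search λ i → ¬? (forces? (g i) p))

  decided? : ∀ c p → Dec (Decided c p)
  decided? c p = forces? c p ⊎-dec forces? (compl c) p

  module GenericPoint (c : BorelCode) where

    -- A requirement a ∷ ns asks that, after its initial segment has been replaced
    -- by enum a, the string decides the descendant at ns: thus the limit is generic
    -- together with all its finite modifications.
    Meets : List ℕ → List Bool → Set
    Meets []       p = ⊤
    Meets (a ∷ ns) p = length α ≤ length p × Decided (descendant c ns) (α ++ drop (length α) p)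
      where α = enum a

    meets? : ∀ ns p → Dec (Meets ns p)
    meets? []       p = yes tt
    meets? (a ∷ ns) p = (_ ≤? _) ×-dec decided? _ _

    Meets-dense : ∀ ns p → ¬ ¬ (∃[ w ] Meets ns (p ++ w))
    Meets-dense []       p none = none ([] , tt)
    Meets-dense (a ∷ ns) p none =
      -- Appending `α` to `p` makes the string long enough to be overwritten.
      Decided-dense (descendant c ns) (α ++ drop (length α) (p ++ α)) λ (w , dec) →
        none (α ++ w , subst (Meets (a ∷ ns)) (++-assoc p α w)
          ( ≤-trans α≤ (≤-trans (m≤m+n _ (length w)) (≤-reflexive (sym (length-++ (p ++ α)))))
          , subst (Decided (descendant c ns))
                  (trans (++-assoc α _ w) (cong (α ++_) (sym (drop-++ α α≤)))) dec))
      where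
      α = enum a
      α≤ : length α ≤ length (p ++ α)
      α≤ = ≤-trans (m≤n+m (length α) (length p)) (≤-reflexive (sym (length-++ p)))

    string : List ℕ → List Bool
    string []      = []
    string (n ∷ h) = enum n

    -- The length of the history numbers the requirement to be met next.
    Good : List ℕ → ℕ → Set
    Good h n = string h ⊑ enum n × Meets (enumℕ* (length h)) (enum n)

    open Histories search Good (λ h n → (string h ⊑? enum n) ×-dec meets? (enumℕ* (length h)) (enum n))
    open Limit string (λ h n (_ , (sub , _) , _) → sub)

    progress : ∀ h → Run h → ¬ ¬ (∃[ n ] Good h n)
    progress h _ none = Meets-dense (enumℕ* (length h)) (string h) λ (w , m) →
      none (index (string h ++ w) ,
            subst (string h ⊑_) (sym (enum-index _)) (⊑-refl ++ᵖ w) ,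
            subst (Meets (enumℕ* (length h))) (sym (enum-index _)) m)

    point : Cantor
    point = limit

    splice-Generic : ∀ α → Generic c (splice α point)
    splice-Generic α ns none =
      -- One move more than the index, so that the last move meets the requirement.
      Run-exists progress (suc (indexℕ* (index α ∷ ns))) λ where
        (n ∷ h , len , r@(_ , (_ , m) , _)) →
          let (α≤ , dec) = subst (λ ms → Meets ms (enum n))
                                 (trans (cong enumℕ* (suc-injective len))
                                        (enumℕ*-index (index α ∷ ns))) m
              (α≤ , dec) = subst (λ β → length β ≤ length (enum n) ×
                                        Decided (descendant c ns) (β ++ drop (length β) (enum n)))
                                 (enum-index α) (α≤ , dec)
          in none (_ , splice-drop-≺ α α≤ (ρ-≺-limit (n ∷ h) r) , dec)

-- The case where WLPO holds

module WLPO-absurd (R : D-Reduction) (search : Searchable ℕ) where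
  open D-Reduction R
  open Forcing search

  -- A single code with every `code σ` among its descendants.
  codes : BorelCode
  codes = union (code ∘ enum)

  x : Cantor
  x = GenericPoint.point codes

  open Game R x

  Generic-code : ∀ σ {y} → Generic codes y → Generic (code σ) y
  Generic-code σ {y} gen ns =
    subst (λ τ → ¬ ¬ (∃[ p ] (p ≺ y × Decided (descendant (code τ) ns) p)))
          (enum-index σ) (gen (index σ ∷ ns))

  -- With `Forces⇒≺`, this is continuity of `f` on generic points.
  ≺⇒Forces : ∀ σ y → Generic codes y → σ ≺ f y → ¬ ¬ (∃[ p ] (p ≺ y × Forces (code σ) p))
  ≺⇒Forces σ y gen σ≺fy = ⟦⟧⇒Forces (code σ) y (Generic-code σ gen) (≺⇒code σ y σ≺fy)

  Forces⇒≺ : ∀ σ y → Generic codes y → ∀ p → p ≺ y → Forces (code σ) p → σ ≺ f y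
  Forces⇒≺ σ y gen p p≺y ⊩ = decidable-stable (≡-dec Bool._≟_ _ _) λ σ⊀ →
    Forces⇒⟦⟧ (code σ) y (Generic-code σ gen) p p≺y ⊩ (σ⊀ ∘ code⇒≺ σ y)

  state : List ℕ → State
  state []      = start
  state (n ∷ h) = act (state h) (enum n)

  len : List ℕ → ℕ
  len []      = 0
  len (n ∷ h) = length (enum n)

  track : Bool → List ℕ → List Bool
  track b h = restrict (pt (state h) b) (len h)

  -- The clauses make the tracks converge, freeze the image up to `bound`, and make the limit
  -- generic.
  Extends : List ℕ → Bool → List Bool → Set
  Extends h b p = track b h ⊑ p
                × Forces (code (restrict (f (pt (state h) b)) (suc (bound (state h))))) p
                × Decided (descendant codes (enumℕ* (length h))) p

  Deviates : List ℕ → List Bool → Set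
  Deviates h α = ∃[ j ] (j < length α × len h ≤ j × pt (act (state h) α) (turn (state h)) j ≢ x j)

  Move : List ℕ → List Bool → Set
  Move h α = (∀ b → Extends h b (restrict (pt (act (state h) α) b) (length α))) × Deviates h α

  move? : ∀ h α → Dec (Move h α)
  move? h α =
    all-Bool? (λ b → (_ ⊑? _) ×-dec forces? _ _ ×-dec decided? _ _) ×-dec
    anyUpTo? (λ j → (len h ≤? j) ×-dec ¬? (_ Bool.≟ x j)) (length α)

  open Histories search (λ h n → Move h (enum n)) (λ h n → move? h (enum n))

  len-< : ∀ h n → Run (n ∷ h) → len h < len (n ∷ h)
  len-< h n (_ , (_ , j , j< , ≤j , _) , _) = ≤-<-trans ≤j j<

  pt-splice : ∀ h → Run h → ∀ b → ∃[ α ] (pt (state h) b ≡ splice α x × length α ≤ len h)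
  pt-splice []      _           b = [] , refl , z≤n
  pt-splice (n ∷ h) run@(r , _) b with b Bool.≟ turn (state h)
  ... | yes _ = enum n , refl , ≤-refl
  ... | no  _ with pt-splice h r b
  ...   | α , eq , α≤ = α , eq , ≤-trans α≤ (<⇒≤ (len-< h n run))

  pt-Generic : ∀ h → Run h → ∀ b → Generic codes (pt (state h) b)
  pt-Generic h r b with pt-splice h r b
  ... | α , eq , _ = subst (Generic codes) (sym eq) (GenericPoint.splice-Generic codes α)

  pt-tail : ∀ h → Run h → ∀ b j → len h ≤ j → pt (state h) b j ≡ x j
  pt-tail h r b j ≤j with pt-splice h r b
  ... | α , eq , α≤ = trans (cong (λ y → y j) eq) (splice-tail α x j (≤-trans α≤ ≤j))

  restrict-⊑ : ∀ y {m n} → m ≤ n → restrict y m ⊑ restrict y n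
  restrict-⊑ y {m} m≤n = ≺⇒⊑restrict (restrict-≺ y m) (≤-trans (≤-reflexive (length-restrict y m)) m≤n)

  progress : ∀ h → Run h → ¬ ¬ (∃[ n ] Move h (enum n))
  progress h r none =
    ≺⇒Forces _ a (pt-Generic h r b) (restrict-≺ (f a) _) λ (p , p≺a , p⊩) →
    ≺⇒Forces _ c (pt-Generic h r (not b)) (restrict-≺ (f c) _) λ (q , q≺c , q⊩) →
    pt-Generic h r (not b) ns λ (s , s≺c , sdec) →
    -- Up to `m` the mover follows `a`, past the prefixes `p`, `q` forcing the images and `s`
    -- deciding the requirement for `c`. Bit `m` is then flipped against `x`, and `w` decides the
    -- requirement for the mover.
    let m = len h ⊔ (length p ⊔ (length q ⊔ length s))
        u = restrict a m ∷ʳ not (x m)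
    in Decided-dense (descendant codes ns) u λ (w , dec) →
    let α    = u ++ w
        pqs≤ = m≤n⊔m (len h) (length p ⊔ (length q ⊔ length s))
        qs≤  = ≤-trans (m≤n⊔m (length p) (length q ⊔ length s)) pqs≤
        h≤   = m≤m⊔n (len h) _
        p≤   = ≤-trans (m≤m⊔n (length p) _) pqs≤
        q≤   = ≤-trans (m≤m⊔n (length q) _) qs≤
        s≤   = ≤-trans (m≤n⊔m (length q) _) qs≤
        m<u  = ≤-reflexive (sym (trans (length-++ (restrict a m))
                 (trans (+-comm _ 1) (cong suc (length-restrict a m)))))
        m<α  = ≤-trans m<u (≤-trans (m≤m+n _ (length w)) (≤-reflexive (sym (length-++ u))))
        a⊑α  = ⊑-trans (⊑-refl {restrict a m} ++ᵖ _) (⊑-refl {u} ++ᵖ w)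
        u≺   = ⊑-≺ (⊑-refl {u} ++ᵖ w) (splice-≺ α x)
        flip : splice α x m ≡ not (x m)
        flip = trans (≺⇒≡ {u} {splice α x} {splice u x} u≺ (splice-≺ u x) m m<u)
                     (splice-∷ʳ a m (not (x m)) x)
        acting : Extends h b (restrict (pt (act S α) b) (length α))
        acting = subst (Extends h b)
          (sym (trans (cong (λ y → restrict y (length α)) (act-turn S α)) (splice-≺ α x)))
          ( ⊑-trans (restrict-⊑ a h≤) a⊑α
          , Forces-⊑ _ (⊑-trans (≺⇒⊑restrict p≺a p≤) a⊑α) p⊩
          , dec )
        waiting : Extends h (not b) (restrict (pt (act S α) (not b)) (length α))
        waiting = subst (Extends h (not b))
          (sym (cong (λ y → restrict y (length α)) (act-other S α (λ e → not-¬ refl (sym e)))))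
          ( restrict-⊑ c (≤-trans h≤ (<⇒≤ m<α))
          , Forces-⊑ _ (≺⇒⊑restrict q≺c (≤-trans q≤ (<⇒≤ m<α))) q⊩
          , Decided-⊑ (descendant codes ns) (≺⇒⊑restrict s≺c (≤-trans s≤ (<⇒≤ m<α))) sdec )
    in none (index α , subst (Move h) (sym (enum-index α))
         ( both {λ b → Extends h b (restrict (pt (act S α) b) (length α))} acting waiting
         , m , m<α , h≤
         , λ eq → not-¬ refl (trans (sym eq)
             (trans (cong (λ y → y m) (act-turn S α)) flip)) ))
    where
    S = state h
    b = turn S
    a = pt S b
    c = pt S (not b)
    ns = enumℕ* (length h)
    both : {P : Bool → Set} → P b → P (not b) → ∀ b′ → P b′
    both {P} pb p¬b b′ with b′ Bool.≟ b
    ... | yes eq = subst P (sym eq) pb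
    ... | no  ne = subst P (sym (¬-not ne)) p¬b

  track-mono : ∀ b h n → Run (n ∷ h) → track b h ⊑ track b (n ∷ h)
  track-mono b h n (_ , (ext , _) , _) = proj₁ (ext b)

  module L (b : Bool) = Limit (track b) (track-mono b)

  Y : Bool → Cantor
  Y b = L.limit b

  -- Forced values bind generic points only, so this is what carries them to the limit.
  Y-Generic : ∀ b → Generic codes (Y b)
  Y-Generic b ns none = Run-exists progress (suc (indexℕ* ns)) λ where
    (n ∷ h , len≡ , r@(_ , (ext , _) , _)) →
      none (track b (n ∷ h) , L.ρ-≺-limit b (n ∷ h) r ,
            subst (λ ms → Decided (descendant codes ms) (track b (n ∷ h)))
                  (trans (cong enumℕ* (suc-injective len≡)) (enumℕ*-index ns))
                  (proj₂ (proj₂ (ext b))))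

  forced-values : ∀ h n → Run (n ∷ h) → ∀ b y → Generic codes y → track b (n ∷ h) ≺ y →
                  ∀ {m} → m < suc (bound (state h)) → f y m ≡ f (pt (state h) b) m
  forced-values h n (_ , (ext , _) , _) b y gen t≺y {m} m< =
    restrict-≺⇒≡ {f (pt (state h) b)} {f y} (suc (bound (state h)))
      (Forces⇒≺ _ y gen _ t≺y (proj₁ (proj₂ (ext b)))) m m<

  -- Moves are admissible: the new point is a finite modification of `x`, hence generic, and its
  -- track forces the old values.
  Run-Separated : ∀ h → Run h → Separated (state h)
  Run-Separated []      _           = start-Separated
  Run-Separated (n ∷ h) run@(r , _) = act-Separated (state h) (Run-Separated h r) λ m< →
    subst (λ y → f y _ ≡ f (pt (state h) b) _) (act-turn (state h) (enum n))
      (forced-values h n run b (pt (state (n ∷ h)) b) (pt-Generic (n ∷ h) run b)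
                     (restrict-≺ _ (len (n ∷ h))) m<)
    where b = turn (state h)

  length≤bound : ∀ h → length h ≤ bound (state h)
  length≤bound []      = z≤n
  length≤bound (n ∷ h) = ≤-<-trans (length≤bound h) (bound-act (state h) (enum n))

  length≤len : ∀ h → Run h → length h ≤ len h
  length≤len []      _           = z≤n
  length≤len (n ∷ h) run@(r , _) = ≤-<-trans (length≤len h r) (len-< h n run)

  Y-track : ∀ h → Run h → ∀ b j → j < len h → Y b j ≡ pt (state h) b j
  Y-track h r b = restrict-≺⇒≡ {pt (state h) b} {Y b} (len h) (L.ρ-≺-limit b h r)

  deviation : ∀ h n → Run (n ∷ h) →
              let b = turn (state h) in ∃[ j ] (len h ≤ j × Y b j ≢ x j × Y (not b) j ≡ x j)
  deviation h n run@(r , (_ , j , j< , ≤j , ≢x) , _) =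
    j , ≤j , ≢x ∘ trans (sym (Y-track (n ∷ h) run b j j<)) ,
    trans (Y-track (n ∷ h) run (not b) j j<)
          (trans (cong (λ y → y j) (act-other (state h) (enum n) (λ e → not-¬ refl (sym e))))
                 (pt-tail h r (not b) j ≤j))
    where b = turn (state h)

  -- Turns alternate at every move, so one of two consecutive lengths serves.
  turn-at : ∀ b n → ¬ ¬ (∃[ h ] (n < length h × Run h × turn (state h) ≡ b))
  turn-at b n none = Run-exists progress (suc n) λ (h , len≡ , r) →
    Run-extend progress h r λ (k , r′) → case turn (state h) Bool.≟ b of λ where
      (yes eq) → none (h , ≤-reflexive (sym len≡) , r , eq)
      (no  ne) → none (k ∷ h , m≤n⇒m≤1+n (≤-reflexive (sym len≡)) , r′ , sym (¬-not (ne ∘ sym)))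

  absurd : ⊥
  absurd = limits-absurd Y
    (λ n none → Run-exists progress n λ (h , len≡ , r) → Run-extend progress h r λ (k , r′) →
      none (state h , Run-Separated h r , λ b m m≤n →
        forced-values h k r′ b (Y b) (Y-Generic b) (L.ρ-≺-limit b (k ∷ h) r′)
          (s≤s (≤-trans m≤n (≤-trans (≤-reflexive (sym len≡)) (length≤bound h))))))
    (λ b n none → turn-at b n λ { (h , n< , r , refl) → Run-extend progress h r λ (k , r′) →
      let (j , ≤j , dev) = deviation h k r′
      in none (j , ≤-trans n< (≤-trans (length≤len h r) ≤j) , dev) })

-- Refutation of the 3-Mycielski property

E0-¬3-Mycielski : ¬ E0-3-Mycielski
E0-¬3-Mycielski mycielski
  with mycielski D ((λ _ → D) , (λ _ → D-open , D-dense) , λ t t∈D → t∈D 0)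
... | A , _ , (F , borel , reduces) , _ , A³⊆D =
  ¬WLPO-absurd.absurd R λ wlpo → WLPO-absurd.absurd R (WLPO⇒Searchable wlpo)
  where
  R : D-Reduction
  R = record
    { f      = proj₁ ∘ F
    ; code   = proj₁ ∘ borel
    ; ≺⇒code = λ σ x → Equivalence.to (proj₂ (borel σ) x)
    ; code⇒≺ = λ σ x → Equivalence.from (proj₂ (borel σ) x)
    ; f-E0   = λ {a} {b} → Equivalence.to (reduces a b)
    ; f-D    = λ {a} {b} {c} a≁b a≁c b≁c →
        A³⊆D _ _ _ (proj₂ (F a)) (proj₂ (F b)) (proj₂ (F c))
          (a≁b ∘ Equivalence.from (reduces a b))
          (a≁c ∘ Equivalence.from (reduces a c))
          (b≁c ∘ Equivalence.from (reduces b c))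
    }

theorem8p1 : IsDenseOpen³ D
    × (∀ (p : E0Tree) (Φ : Cantor → Cantor) → IsCanonicalMap p Φ →
    ¬ D (Φ (tilde (false ∷ true ∷ false ∷ [])) ,
    Φ (tilde (true ∷ true ∷ false ∷ [])) ,
    Φ (tilde (true ∷ []))))
    × ¬ E0-3-Mycielski
theorem8p1 = (D-open , D-dense) , Φ-tilde∉D , E0-¬3-Mycielski
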